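{- Let $\Gamma\cup\{\varphi\}\subseteq For(\Sigma)$. If $\Gamma\vdash_{\mathbf{RmbC}}\varphi$ then $\Gamma\models_{\mathbb{BI}}\varphi$.
   Context: Let $\Sigma=\{\wedge,\vee,\to,\neg,\circ\}$ ($\neg,\circ$ unary, the others binary) and let $For(\Sigma)$ be the algebra of formulas over $\Sigma$ generated by a denumerable set $\mathcal V$ of propositional variables. $\alpha\leftrightarrow\beta$ abbreviates $(\alpha\to\beta)\wedge(\beta\to\alpha)$. $\mathbf{RmbC}$ is the Hilbert calculus with axiom schemas: (Ax1) $\alpha\to(\beta\to\alpha)$; (Ax2) $(\alpha\to(\beta\to\gamma))\to((\alpha\to\beta)\to(\alpha\to\gamma))$; (Ax3) $\alpha\to(\beta\to(\alpha\wedge\beta))$; (Ax4) $(\alpha\wedge\beta)\to\alpha$; (Ax5) $(\alpha\wedge\beta)\to\beta$; (Ax6) $\alpha\to(\alpha\vee\beta)$; (Ax7) $\beta\to(\alpha\vee\beta)$; (Ax8) $(\alpha\to\gamma)\to((\beta\to\gamma)\to((\alpha\vee\beta)\to\gamma))$; (Ax9) $(\alpha\to\beta)\vee\alpha$; (Ax10) $\alpha\vee\neg\alpha$; (bc1) $\circ\alpha\to(\alpha\to(\neg\alpha\to\beta))$; and rules: (MP) from $\alpha$ and $\alpha\to\beta$ infer $\beta$; $(\mathbf R_\neg)$ from $\alpha\leftrightarrow\beta$ infer $\neg\alpha\leftrightarrow\neg\beta$; $(\mathbf R_\circ)$ from $\alpha\leftrightarrow\beta$ infer $\circ\alpha\leftrightarrow\circ\beta$.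 A formula $\varphi$ is a theorem ($\vdash_{\mathbf{RmbC}}\varphi$) if there is a finite sequence of formulas ending in $\varphi$ each of which is an instance of an axiom schema or follows from earlier formulas of the sequence by a rule. $\Gamma\vdash_{\mathbf{RmbC}}\varphi$ means that either $\vdash_{\mathbf{RmbC}}\varphi$ or there is a finite non-empty $\{\gamma_1,\dots,\gamma_n\}\subseteq\Gamma$ with $\vdash_{\mathbf{RmbC}}(\gamma_1\wedge(\gamma_2\wedge(\cdots\wedge(\gamma_{n-1}\wedge\gamma_n)\cdots)))\to\varphi$. A Boolean algebra with LFI operators (BALFI) is an algebra $\mathcal B=\langle A,\wedge,\vee,\to,\neg,\circ,0,1\rangle$ such that $\langle A,\wedge,\vee,\to,0,1\rangle$ is a Boolean algebra (with $a\to b$ the Boolean implication) and the unary operations $\neg,\circ$ satisfy $a\vee\neg a=1$ and $a\wedge\neg a\wedge\circ a=0$ for all $a\in A$. $\mathbb{BI}$ is the class of BALFIs. A valuation over $\mathcal B$ is a $\Sigma$-homomorphism $v:For(\Sigma)\to\mathcal B$. $\models_{\mathbb{BI}}\varphi$ means $v(\varphi)=1$ for every BALFI $\mathcal B$ and every valuation $v$ over it. $\Gamma\models_{\mathbb{BI}}\varphi$ means that either $\models_{\mathbb{BI}}\varphi$ or there is a finite non-empty $\{\gamma_1,\dots,\gamma_n\}\subseteq\Gamma$ such that $\bigwedge_{i=1}^n v(\gamma_i)\le v(\varphi)$ for every BALFI $\mathcal B$ and every valuation $v$ over it. -}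

module Defs where

open import Level using (Level; suc; _⊔_)
open import Algebra.Core using (Op₁; Op₂)
open import Algebra.Definitions using (Congruent₁)
open import Algebra.Lattice.Bundles using (BooleanAlgebra)
open import Algebra.Lattice.Structures using (IsBooleanAlgebra)
open import Algebra.Lattice.Properties.BooleanAlgebra using (poset)
open import Data.List.Base using (List; []; _∷_)
open import Data.List.Membership.Propositional using (_∈_)
open import Data.List.NonEmpty.Base using (List⁺; foldr₁; map)
open import Data.List.NonEmpty.Relation.Unary.All using (All)
open import Data.Nat.Base using (ℕ)
open import Data.Product.Base using (∃-syntax; _×_)
open import Data.Sum.Base using (_⊎_)
open import Relation.Binary.Bundles using (Poset)
open import Relation.Binary.Core using (Rel)
open import Relation.Unary using (Pred)

-- The Boolean complement is a ⇒ ⊥; it is unrelated to the paraconsistent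
-- negation ¬. Equality is a setoid equality, so ¬ and ○ carry congruence laws
-- (that of ⇒ follows from ⇒-boolean). The one-element algebra is not excluded.
record BALFI (c ℓ : Level) : Set (suc (c ⊔ ℓ)) where
  infix  8 ¬_ ○_
  infixr 7 _∧_
  infixr 6 _∨_
  infixr 5 _⇒_
  infix  4 _≈_
  field
    Carrier          : Set c
    _≈_              : Rel Carrier ℓ
    _∧_ _∨_ _⇒_      : Op₂ Carrier
    ¬_ ○_            : Op₁ Carrier
    ⊥ ⊤              : Carrier
    isBooleanAlgebra : IsBooleanAlgebra _≈_ _∨_ _∧_ (_⇒ ⊥) ⊤ ⊥
    ⇒-boolean        : ∀ a b → a ⇒ b ≈ (a ⇒ ⊥) ∨ b
    ¬-cong           : Congruent₁ _≈_ ¬_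
    ○-cong           : Congruent₁ _≈_ ○_
    ∨-¬              : ∀ a → a ∨ ¬ a ≈ ⊤
    ∧-¬-○            : ∀ a → a ∧ ¬ a ∧ ○ a ≈ ⊥

  booleanAlgebra : BooleanAlgebra c ℓ
  booleanAlgebra = record { isBooleanAlgebra = isBooleanAlgebra }

  -- a ≤ b unfolds to a ≈ a ∧ b.
  open Poset (poset booleanAlgebra) public using (_≤_)

infix  8 ¬_ ○_
infixr 7 _∧_
infixr 6 _∨_
infixr 5 _⇒_
infix  4 _⇔_

data Formula : Set where
  var         : ℕ → Formula
  _∧_ _∨_ _⇒_ : Formula → Formula → Formula
  ¬_ ○_       : Formula → Formula

_⇔_ : Formula → Formula → Formula
α ⇔ β = (α ⇒ β) ∧ (β ⇒ α)

data Axiom : Formula → Set where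
  ax1  : ∀ α β → Axiom (α ⇒ (β ⇒ α))
  ax2  : ∀ α β γ → Axiom ((α ⇒ (β ⇒ γ)) ⇒ ((α ⇒ β) ⇒ (α ⇒ γ)))
  ax3  : ∀ α β → Axiom (α ⇒ (β ⇒ (α ∧ β)))
  ax4  : ∀ α β → Axiom ((α ∧ β) ⇒ α)
  ax5  : ∀ α β → Axiom ((α ∧ β) ⇒ β)
  ax6  : ∀ α β → Axiom (α ⇒ (α ∨ β))
  ax7  : ∀ α β → Axiom (β ⇒ (α ∨ β))
  ax8  : ∀ α β γ → Axiom ((α ⇒ γ) ⇒ ((β ⇒ γ) ⇒ ((α ∨ β) ⇒ γ)))
  ax9  : ∀ α β → Axiom ((α ⇒ β) ∨ α)
  ax10 : ∀ α → Axiom (α ∨ ¬ α)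
  bc1  : ∀ α β → Axiom (○ α ⇒ (α ⇒ (¬ α ⇒ β)))

data Follows (earlier : List Formula) : Formula → Set where
  axiom : ∀ {α} → Axiom α → Follows earlier α
  mp    : ∀ {α β} → α ∈ earlier → (α ⇒ β) ∈ earlier → Follows earlier β
  R¬    : ∀ {α β} → (α ⇔ β) ∈ earlier → Follows earlier (¬ α ⇔ ¬ β)
  R○    : ∀ {α β} → (α ⇔ β) ∈ earlier → Follows earlier (○ α ⇔ ○ β)

-- Derivations are listed backwards: the head is the last formula.
data Derivation : List Formula → Set where
  []  : Derivation []
  _∷_ : ∀ {φ earlier} → Follows earlier φ → Derivation earlier →
        Derivation (φ ∷ earlier)

infix 3 ⊢_ _⊢_ _⊨[_,_]_ ⊨[_,_]_

⊢_ : Formula → Set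
⊢ φ = ∃[ earlier ] Derivation (φ ∷ earlier)

-- Finite non-empty subsets of Γ are given by enumerations, possibly with
-- repetitions; foldr₁ associates to the right.
_⊢_ : ∀ {g} → Pred Formula g → Formula → Set g
Γ ⊢ φ = (⊢ φ) ⊎ (∃[ γs ] All Γ γs × (⊢ foldr₁ _∧_ γs ⇒ φ))

record Valuation {c ℓ : Level} (B : BALFI c ℓ) : Set (c ⊔ ℓ) where
  private module B = BALFI B
  field
    ⟦_⟧   : Formula → B.Carrier
    ∧-hom : ∀ α β → ⟦ α ∧ β ⟧ B.≈ ⟦ α ⟧ B.∧ ⟦ β ⟧
    ∨-hom : ∀ α β → ⟦ α ∨ β ⟧ B.≈ ⟦ α ⟧ B.∨ ⟦ β ⟧
    ⇒-hom : ∀ α β → ⟦ α ⇒ β ⟧ B.≈ ⟦ α ⟧ B.⇒ ⟦ β ⟧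
    ¬-hom : ∀ α → ⟦ ¬ α ⟧ B.≈ B.¬ ⟦ α ⟧
    ○-hom : ∀ α → ⟦ ○ α ⟧ B.≈ B.○ ⟦ α ⟧

-- The levels c and ℓ bound the size of the BALFIs quantified over.
⊨[_,_]_ : (c ℓ : Level) → Formula → Set (suc (c ⊔ ℓ))
⊨[ c , ℓ ] φ = (B : BALFI c ℓ) (v : Valuation B) →
  let open BALFI B; open Valuation v in ⟦ φ ⟧ ≈ ⊤

_⊨[_,_]_ : ∀ {g} → Pred Formula g → (c ℓ : Level) → Formula →
           Set (g ⊔ suc (c ⊔ ℓ))
Γ ⊨[ c , ℓ ] φ =
  (⊨[ c , ℓ ] φ) ⊎
  (∃[ γs ] All Γ γs ×
    ((B : BALFI c ℓ) (v : Valuation B) →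
      let module B = BALFI B; open Valuation v in
      foldr₁ B._∧_ (map ⟦_⟧ γs) B.≤ ⟦ φ ⟧))

{-# OPTIONS --safe #-}

-- In a Boolean algebra, w ≤ a ⇒ b is equivalent to w ∧ a ≤ b, so w ≤ ⟦ α ⟧ obeys
-- the rules of natural deduction with w as the context. The rules R¬ and R○ are sound
-- because ⟦ α ⇔ β ⟧ ≈ ⊤ forces ⟦ α ⟧ ≈ ⟦ β ⟧, and ¬ and ○ are congruent.
module Submission where

open import Defs
open import Level using (Level)
open import Relation.Unary using (Pred)
import Algebra.Lattice.Properties.BooleanAlgebra as BooleanAlgebraProperties
open import Algebra.Lattice.Bundles using (BooleanAlgebra)
open import Data.List.Base using ([]; _∷_)
open import Data.List.NonEmpty.Base using (_∷_; foldr₁; map)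
open import Data.List.Relation.Unary.All using (All; []; _∷_; head; lookup)
open import Data.Product.Base using (_,_)
open import Data.Sum.Base using (inj₁; inj₂)
open import Relation.Binary.Lattice.Bundles using (HeytingAlgebra; Lattice)
open import Relation.Binary.Lattice.Definitions using (Exponential)
import Relation.Binary.Lattice.Properties.HeytingAlgebra as HeytingAlgebraProperties
import Relation.Binary.Lattice.Properties.JoinSemilattice as JoinSemilatticeProperties
import Relation.Binary.Lattice.Properties.MeetSemilattice as MeetSemilatticeProperties
import Relation.Binary.Reasoning.PartialOrder as ≤-Reasoning

module BALFIProperties {c ℓ} (B : BALFI c ℓ) where
  private module B = BALFI B
  open B using (_≤_; ⊤; ⊥)
  open BooleanAlgebra B.booleanAlgebra
    using (sym; ∧-congˡ; ∧-comm; ∧-distribˡ-∨; ∨-complementˡ; ∧-complementʳ)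
  open BooleanAlgebraProperties B.booleanAlgebra
    using (∨-∧-orderTheoreticLattice; ∧-identityʳ; ∧-zeroˡ)
  open Lattice ∨-∧-orderTheoreticLattice
    using (isLattice; poset; meetSemilattice; joinSemilattice;
           refl; trans; reflexive; x∧y≤y; ∨-least)
  open JoinSemilatticeProperties joinSemilattice using (∨-monotonic)
  open MeetSemilatticeProperties meetSemilattice using (∧-monotonic)

  minimum : ∀ x → ⊥ ≤ x
  minimum x = sym (∧-zeroˡ x)

  -- Both directions rest on reading `x ⇒ y` as the join of the complement `x ⇒ ⊥` with `y`. To
  -- curry, split `w` into its parts inside and outside `x`; to uncurry, distribute `x` over this
  -- join, where the part with the complement vanishes.
  exponential : Exponential _≤_ B._∧_ B._⇒_
  exponential w x y = curry , uncurry
    where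
    open ≤-Reasoning poset

    curry : w B.∧ x ≤ y → w ≤ x B.⇒ y
    curry w∧x≤y = begin
      w                                ≈⟨ ∧-identityʳ w ⟨
      w B.∧ ⊤                          ≈⟨ ∧-congˡ (∨-complementˡ x) ⟨
      w B.∧ ((x B.⇒ ⊥) B.∨ x)          ≈⟨ ∧-distribˡ-∨ w (x B.⇒ ⊥) x ⟩
      w B.∧ (x B.⇒ ⊥) B.∨ w B.∧ x      ≤⟨ ∨-monotonic (x∧y≤y w (x B.⇒ ⊥)) w∧x≤y ⟩
      (x B.⇒ ⊥) B.∨ y                  ≈⟨ B.⇒-boolean x y ⟨
      x B.⇒ y                          ∎

    uncurry : w ≤ x B.⇒ y → w B.∧ x ≤ y
    uncurry w≤x⇒y = begin
      w B.∧ x                          ≤⟨ ∧-monotonic w≤x⇒y refl ⟩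
      (x B.⇒ y) B.∧ x                  ≈⟨ ∧-comm (x B.⇒ y) x ⟩
      x B.∧ (x B.⇒ y)                  ≈⟨ ∧-congˡ (B.⇒-boolean x y) ⟩
      x B.∧ ((x B.⇒ ⊥) B.∨ y)          ≈⟨ ∧-distribˡ-∨ x (x B.⇒ ⊥) y ⟩
      x B.∧ (x B.⇒ ⊥) B.∨ x B.∧ y      ≤⟨ ∨-least (trans (reflexive (∧-complementʳ x)) (minimum y)) (x∧y≤y x y) ⟩
      y                                ∎

  heytingAlgebra : HeytingAlgebra c ℓ ℓ
  heytingAlgebra = record
    { isHeytingAlgebra = record
      { isBoundedLattice = record
        { isLattice = isLattice
        ; maximum   = λ x → sym (∧-identityʳ x)
        ; minimum   = minimum
        }
      ; exponential = exponential
      }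
    }

  open HeytingAlgebraProperties heytingAlgebra using (⇨ʳ-covariant)

  -- The classical ingredient, which Heyting laws alone do not give: the complement `x ⇒ ⊥` lies
  -- below `x ⇒ y`, and its join with `x` is `⊤`.
  ⇒-∨-⊤ : ∀ x y → ⊤ ≤ (x B.⇒ y) B.∨ x
  ⇒-∨-⊤ x y = trans (reflexive (sym (∨-complementˡ x)))
                    (∨-monotonic (⇨ʳ-covariant (minimum y)) refl)

module Soundness {c ℓ} {B : BALFI c ℓ} (v : Valuation B) where
  private module B = BALFI B
  open B using (_≤_; _≈_; ⊤; ⊥)
  open Valuation v
  open BALFIProperties B using (heytingAlgebra; ⇒-∨-⊤)
  open HeytingAlgebra heytingAlgebra
    using (poset; meetSemilattice; module Eq; refl; trans; reflexive; antisym;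
           maximum; minimum; transpose-⇨; transpose-∧;
           x∧y≤x; x∧y≤y; ∧-greatest; x≤x∨y; y≤x∨y; ∨-least)
  open MeetSemilatticeProperties meetSemilattice using (∧-cong)
  open HeytingAlgebraProperties heytingAlgebra using (swap-transpose-⇨)

  ⇒-intro : ∀ {w α β} → w B.∧ ⟦ α ⟧ ≤ ⟦ β ⟧ → w ≤ ⟦ α ⇒ β ⟧
  ⇒-intro p = trans (transpose-⇨ p) (reflexive (Eq.sym (⇒-hom _ _)))

  ⇒-elim : ∀ {w α β} → w ≤ ⟦ α ⇒ β ⟧ → w ≤ ⟦ α ⟧ → w ≤ ⟦ β ⟧
  ⇒-elim p q = trans (∧-greatest refl q) (transpose-∧ (trans p (reflexive (⇒-hom _ _))))

  ∧-intro : ∀ {w α β} → w ≤ ⟦ α ⟧ → w ≤ ⟦ β ⟧ → w ≤ ⟦ α ∧ β ⟧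
  ∧-intro p q = trans (∧-greatest p q) (reflexive (Eq.sym (∧-hom _ _)))

  ∧-elim₁ : ∀ {w α β} → w ≤ ⟦ α ∧ β ⟧ → w ≤ ⟦ α ⟧
  ∧-elim₁ p = trans p (trans (reflexive (∧-hom _ _)) (x∧y≤x _ _))

  ∧-elim₂ : ∀ {w α β} → w ≤ ⟦ α ∧ β ⟧ → w ≤ ⟦ β ⟧
  ∧-elim₂ p = trans p (trans (reflexive (∧-hom _ _)) (x∧y≤y _ _))

  ∨-intro₁ : ∀ {w α β} → w ≤ ⟦ α ⟧ → w ≤ ⟦ α ∨ β ⟧
  ∨-intro₁ p = trans p (trans (x≤x∨y _ _) (reflexive (Eq.sym (∨-hom _ _))))

  ∨-intro₂ : ∀ {w α β} → w ≤ ⟦ β ⟧ → w ≤ ⟦ α ∨ β ⟧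
  ∨-intro₂ p = trans p (trans (y≤x∨y _ _) (reflexive (Eq.sym (∨-hom _ _))))

  -- Since `∨-least` allows no side context, `w` is first moved into the goal: each disjunct lies
  -- below `w ⇒ ⟦ γ ⟧`, hence so does their join.
  ∨-elim : ∀ {w α β γ} → w ≤ ⟦ α ⇒ γ ⟧ → w ≤ ⟦ β ⇒ γ ⟧ → w ≤ ⟦ α ∨ β ⟧ → w ≤ ⟦ γ ⟧
  -- Contraction: `w ≤ w ∧ w`, where one copy discharges the antecedent `w` and the other supplies
  -- the disjunction.
  ∨-elim {w} {γ = γ} p q r = trans (∧-greatest refl refl) (transpose-∧ w≤w⇒γ)
    where
    branch : ∀ {δ} → w ≤ ⟦ δ ⇒ γ ⟧ → ⟦ δ ⟧ ≤ w B.⇒ ⟦ γ ⟧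
    branch s = swap-transpose-⇨ (transpose-∧ (trans s (reflexive (⇒-hom _ _))))

    w≤w⇒γ : w ≤ w B.⇒ ⟦ γ ⟧
    w≤w⇒γ = trans r (trans (reflexive (∨-hom _ _)) (∨-least (branch p) (branch q)))

  ⇒-or-antecedent : ∀ {w α β} → w ≤ ⟦ (α ⇒ β) ∨ α ⟧
  ⇒-or-antecedent {w} {α} {β} = begin
    w                                  ≤⟨ maximum w ⟩
    ⊤                                  ≤⟨ ⇒-∨-⊤ ⟦ α ⟧ ⟦ β ⟧ ⟩
    -- Each disjunct serves as its own context for the introduction rules.
    (⟦ α ⟧ B.⇒ ⟦ β ⟧) B.∨ ⟦ α ⟧        ≤⟨ ∨-least (∨-intro₁ (reflexive (Eq.sym (⇒-hom α β)))) (∨-intro₂ refl) ⟩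
    ⟦ (α ⇒ β) ∨ α ⟧                    ∎
    where open ≤-Reasoning poset

  excluded-middle : ∀ {w α} → w ≤ ⟦ α ∨ ¬ α ⟧
  excluded-middle {w} {α} = begin
    w                        ≤⟨ maximum w ⟩
    ⊤                        ≈⟨ B.∨-¬ ⟦ α ⟧ ⟨
    ⟦ α ⟧ B.∨ B.¬ ⟦ α ⟧      ≤⟨ ∨-least (∨-intro₁ refl) (∨-intro₂ (reflexive (Eq.sym (¬-hom α)))) ⟩
    ⟦ α ∨ ¬ α ⟧              ∎
    where open ≤-Reasoning poset

  gentle-explosion : ∀ {w α β} → w ≤ ⟦ ○ α ⟧ → w ≤ ⟦ α ⟧ → w ≤ ⟦ ¬ α ⟧ → w ≤ ⟦ β ⟧
  gentle-explosion {w} {α} {β} p q r = begin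
    -- The hypotheses are reordered to match the law `∧-¬-○`.
    w                                      ≤⟨ ∧-greatest q (∧-greatest r p) ⟩
    ⟦ α ⟧ B.∧ ⟦ ¬ α ⟧ B.∧ ⟦ ○ α ⟧          ≈⟨ ∧-cong Eq.refl (∧-cong (¬-hom α) (○-hom α)) ⟩
    ⟦ α ⟧ B.∧ B.¬ ⟦ α ⟧ B.∧ B.○ ⟦ α ⟧      ≈⟨ B.∧-¬-○ ⟦ α ⟧ ⟩
    ⊥                                      ≤⟨ minimum ⟦ β ⟧ ⟩
    ⟦ β ⟧                                  ∎
    where open ≤-Reasoning poset

  -- De Bruijn indices into a context associated to the left.
  #0 : ∀ {w a} → w B.∧ a ≤ a
  #0 = x∧y≤y _ _

  #1 : ∀ {w a b} → (w B.∧ a) B.∧ b ≤ a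
  #1 = trans (x∧y≤x _ _) #0

  #2 : ∀ {w a b c} → ((w B.∧ a) B.∧ b) B.∧ c ≤ a
  #2 = trans (x∧y≤x _ _) #1

  -- Each clause is a natural deduction proof term for its schema, with the antecedents pushed onto
  -- the arbitrary context `w`.
  axiom-sound : ∀ {φ w} → Axiom φ → w ≤ ⟦ φ ⟧
  axiom-sound (ax1 α β)   = ⇒-intro (⇒-intro #1)
  axiom-sound (ax2 α β γ) = ⇒-intro (⇒-intro (⇒-intro (⇒-elim (⇒-elim #2 #0) (⇒-elim #1 #0))))
  axiom-sound (ax3 α β)   = ⇒-intro (⇒-intro (∧-intro #1 #0))
  axiom-sound (ax4 α β)   = ⇒-intro (∧-elim₁ #0)
  axiom-sound (ax5 α β)   = ⇒-intro (∧-elim₂ #0)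
  axiom-sound (ax6 α β)   = ⇒-intro (∨-intro₁ #0)
  axiom-sound (ax7 α β)   = ⇒-intro (∨-intro₂ #0)
  axiom-sound (ax8 α β γ) = ⇒-intro (⇒-intro (⇒-intro (∨-elim #2 #1 #0)))
  axiom-sound (ax9 α β)   = ⇒-or-antecedent
  axiom-sound (ax10 α)    = excluded-middle
  axiom-sound (bc1 α β)   = ⇒-intro (⇒-intro (⇒-intro (gentle-explosion #2 #1 #0)))

  -- Take `⟦ α ⟧` itself as the context; being below `⊤`, it inherits the implication.
  ⇒-valid⁻ : ∀ {α β} → ⊤ ≤ ⟦ α ⇒ β ⟧ → ⟦ α ⟧ ≤ ⟦ β ⟧
  ⇒-valid⁻ p = ⇒-elim (trans (maximum _) p) refl

  ⇔-valid⁻ : ∀ {α β} → ⊤ ≤ ⟦ α ⇔ β ⟧ → ⟦ α ⟧ ≈ ⟦ β ⟧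
  ⇔-valid⁻ p = antisym (⇒-valid⁻ (∧-elim₁ p)) (⇒-valid⁻ (∧-elim₂ p))

  ⇔-valid⁺ : ∀ {α β} → ⟦ α ⟧ ≈ ⟦ β ⟧ → ⊤ ≤ ⟦ α ⇔ β ⟧
  ⇔-valid⁺ eq = ∧-intro (⇒-intro (trans #0 (reflexive eq)))
                        (⇒-intro (trans #0 (reflexive (Eq.sym eq))))

  -- The context is now fixed to `⊤`: congruence of `¬` and `○` needs an equality of values, and
  -- `w ≤ ⟦ α ⇔ β ⟧` for a smaller `w` does not yield one.
  follows-sound : ∀ {φ earlier} → All (λ α → ⊤ ≤ ⟦ α ⟧) earlier →
                  Follows earlier φ → ⊤ ≤ ⟦ φ ⟧
  follows-sound valid (axiom ax)   = axiom-sound ax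
  follows-sound valid (mp α∈ α⇒β∈) = ⇒-elim (lookup valid α⇒β∈) (lookup valid α∈)
  follows-sound valid (R¬ α⇔β∈)    = ⇔-valid⁺
    (Eq.trans (¬-hom _) (Eq.trans (B.¬-cong (⇔-valid⁻ (lookup valid α⇔β∈))) (Eq.sym (¬-hom _))))
  follows-sound valid (R○ α⇔β∈)    = ⇔-valid⁺
    (Eq.trans (○-hom _) (Eq.trans (B.○-cong (⇔-valid⁻ (lookup valid α⇔β∈))) (Eq.sym (○-hom _))))

  -- Validity is carried for the whole list, because a rule may cite any earlier formula.
  derivation-sound : ∀ {φs} → Derivation φs → All (λ α → ⊤ ≤ ⟦ α ⟧) φs
  derivation-sound []      = []
  derivation-sound (f ∷ d) = follows-sound (derivation-sound d) f ∷ derivation-sound d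

  ⊢-sound : ∀ {φ} → ⊢ φ → ⊤ ≤ ⟦ φ ⟧
  ⊢-sound (_ , d) = head (derivation-sound d)

  -- Bridges the two notions of consequence: derivability conjoins the premises as formulas,
  -- semantic consequence takes the meet of their values.
  foldr₁-∧-hom : ∀ γ γs → ⟦ foldr₁ _∧_ (γ ∷ γs) ⟧ ≈ foldr₁ B._∧_ (map ⟦_⟧ (γ ∷ γs))
  foldr₁-∧-hom γ []       = Eq.refl
  foldr₁-∧-hom γ (δ ∷ γs) = Eq.trans (∧-hom _ _) (∧-cong Eq.refl (foldr₁-∧-hom δ γs))

theorem2p14 : ∀ {g} (c ℓ : Level) (Γ : Pred Formula g) (φ : Formula) →
    Γ ⊢ φ → Γ ⊨[ c , ℓ ] φ
theorem2p14 c ℓ Γ φ (inj₁ ⊢φ) = inj₁ λ B v →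
  let open HeytingAlgebra (BALFIProperties.heytingAlgebra B) using (antisym; maximum)
  in antisym (maximum _) (Soundness.⊢-sound v ⊢φ)
-- The premises of the derivation are reused as the semantic witness, chosen before `B` and `v`.
-- They occur only in the antecedent of a theorem, so soundness for theorems suffices.
theorem2p14 c ℓ Γ φ (inj₂ (γ ∷ γs , Γ∋γs , ⊢⋀γs⇒φ)) = inj₂ (γ ∷ γs , Γ∋γs , λ B v →
  let open HeytingAlgebra (BALFIProperties.heytingAlgebra B) using (trans; reflexive; module Eq)
      open Soundness v
  in trans (reflexive (Eq.sym (foldr₁-∧-hom γ γs))) (⇒-valid⁻ (⊢-sound ⊢⋀γs⇒φ)))
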